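{- Let $\Sigma\subseteq\mathbb{F}'_{(\infty)}$ be a consistent set of propositions and let $\Sigma'\supseteq\Sigma$ be a maximal consistent extension of $\Sigma$ in $\mathbb{F}'_{(\infty)}$. Define $$\tilde{\vee}:\Sigma'\times\Sigma'\to\Sigma',\quad(\alpha,\beta)\mapsto\alpha\vee\beta,$$ $$\tilde{l}:\Sigma'\times\Sigma'\to\Sigma',\quad(\alpha,\beta)\mapsto\alpha\, l\,\beta:=(\neg\alpha\vee\beta)\wedge(\neg\beta\vee\alpha).$$ Then $(\Sigma',\tilde{l},\tilde{\vee})$ is a commutative ring, with $\tilde{l}$ as addition and $\tilde{\vee}$ as multiplication.
   Context: $\mathcal{A}$ is a countably infinite alphabet. Put $\mathbb{F}_0=\mathcal{A}$, $\mathbb{F}_n=\{\neg\alpha\mid\alpha\in\mathbb{F}_{n-1}\}\cup\{(\alpha\ast\beta)\mid\alpha,\beta\in\mathbb{F}_{n-1},\ \ast\in\{\vee,\wedge\}\}\cup\mathbb{F}_{n-1}$, and $\mathbb{F}_{(\infty)}=\bigcup_{n\ge 0}\mathbb{F}_n$. Write $\alpha\equiv\beta$ iff $\hat v(\alpha)=\hat v(\beta)$ for every boolean valuation $v:\mathbb{F}_0\to\{0,1\}$ (with $\hat v$ its extension to formulas). Then $\mathbb{F}'_{(\infty)}=\mathbb{F}_{(\infty)}/\equiv$ (the Lindenbaum algebra over $\mathcal{A}$), with $\wedge,\vee,\neg$ defined on classes through representatives. Consistency is in the usual sense of classical propositional logic; a maximal consistent set is closed under deduction. "Ring" does not require a multiplicative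 identity. -}

module Defs where

open import Level using (Level; suc)
open import Algebra.Core using (Op₂)
open import Data.Bool.Base as Bool using (Bool)
open import Data.Product.Base using (∃; _×_; _,_; proj₁)
open import Function.Base using (_on_)
open import Relation.Binary.Core using (Rel)
open import Relation.Binary.Definitions using (_Respects_)
open import Relation.Binary.PropositionalEquality.Core using (_≡_)
open import Relation.Nullary.Negation.Core as Negation using ()
open import Relation.Unary using (Pred; _∈_; _⊆_; _∪_; ｛_｝)

private
  variable
    ℓ : Level
    A : Set

infix  8 ¬_
infixr 7 _∧_
infixr 6 _∨_
infix  5 _l_
infix  4 _≋_ _⊢_

-- The union of the strata 𝔽₀ ⊆ 𝔽₁ ⊆ … over the alphabet A.
data Formula (A : Set) : Set where
  atom    : A → Formula A
  ¬_      : Formula A → Formula A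
  _∧_ _∨_ : Op₂ (Formula A)

_l_ : Op₂ (Formula A)
α l β = (¬ α ∨ β) ∧ (¬ β ∨ α)

eval : (A → Bool) → Formula A → Bool
eval v (atom p) = v p
eval v (¬ α)    = Bool.not (eval v α)
eval v (α ∧ β)  = eval v α Bool.∧ eval v β
eval v (α ∨ β)  = eval v α Bool.∨ eval v β

-- The Lindenbaum algebra is the setoid (Formula A , _≋_): propositions are
-- formulas, and equality of propositions is _≋_.
_≋_ : Rel (Formula A) _
α ≋ β = ∀ v → eval v α ≡ eval v β

-- Natural deduction for classical propositional logic.  The premises may form
-- an infinite set; a derivation, being finite, uses finitely many of them.
data _⊢_ {A : Set} (Γ : Pred (Formula A) ℓ) : Formula A → Set ℓ where
  ax  : ∀ {α} → α ∈ Γ → Γ ⊢ α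
  ∧I  : ∀ {α β} → Γ ⊢ α → Γ ⊢ β → Γ ⊢ α ∧ β
  ∧E₁ : ∀ {α β} → Γ ⊢ α ∧ β → Γ ⊢ α
  ∧E₂ : ∀ {α β} → Γ ⊢ α ∧ β → Γ ⊢ β
  ∨I₁ : ∀ {α β} → Γ ⊢ α → Γ ⊢ α ∨ β
  ∨I₂ : ∀ {α β} → Γ ⊢ β → Γ ⊢ α ∨ β
  ∨E  : ∀ {α β γ} → Γ ⊢ α ∨ β → Γ ∪ ｛ α ｝ ⊢ γ → Γ ∪ ｛ β ｝ ⊢ γ → Γ ⊢ γ
  ¬I  : ∀ {α β} → Γ ∪ ｛ α ｝ ⊢ β → Γ ∪ ｛ α ｝ ⊢ ¬ β → Γ ⊢ ¬ α
  RAA : ∀ {α β} → Γ ∪ ｛ ¬ α ｝ ⊢ β → Γ ∪ ｛ ¬ α ｝ ⊢ ¬ β → Γ ⊢ α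

-- A set of propositions is a subset of the quotient Formula A / _≋_, given by
-- the set of all formulas representing its members.
record PropositionSet (A : Set) (ℓ : Level) : Set (suc ℓ) where
  field
    ⟦_⟧  : Pred (Formula A) ℓ
    resp : ⟦_⟧ Respects _≋_

open PropositionSet public

Consistent : PropositionSet A ℓ → Set ℓ
Consistent Γ = Negation.¬ ∃ λ α → (⟦ Γ ⟧ ⊢ α) × (⟦ Γ ⟧ ⊢ ¬ α)

MaximalConsistent : PropositionSet A ℓ → Set (suc ℓ)
MaximalConsistent {A} {ℓ} Γ =
  Consistent Γ ×
  (∀ (Δ : PropositionSet A ℓ) → Consistent Δ → ⟦ Γ ⟧ ⊆ ⟦ Δ ⟧ → ⟦ Δ ⟧ ⊆ ⟦ Γ ⟧)

Element : PropositionSet A ℓ → Set ℓ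
Element Γ = ∃ λ α → α ∈ ⟦ Γ ⟧

-- Membership proofs are irrelevant to equality of elements.
Equal : (Γ : PropositionSet A ℓ) → Rel (Element Γ) _
Equal Γ = _≋_ on proj₁

ClosedUnder : PropositionSet A ℓ → Op₂ (Formula A) → Set ℓ
ClosedUnder Γ _∙_ = ∀ α β → α ∈ ⟦ Γ ⟧ → β ∈ ⟦ Γ ⟧ → (α ∙ β) ∈ ⟦ Γ ⟧

restrict : (Γ : PropositionSet A ℓ) (_∙_ : Op₂ (Formula A)) →
           ClosedUnder Γ _∙_ → Op₂ (Element Γ)
restrict Γ _∙_ closed (α , α∈Γ) (β , β∈Γ) = α ∙ β , closed α β α∈Γ β∈Γ

{-# OPTIONS --safe #-}
-- Modulo ≋, equivalence and disjunction are the addition and multiplication of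
-- the order dual of the usual Boolean ring: zero is a tautology and every
-- element is its own negative.  What remains is that Σ′ is closed under
-- consequence; by maximality it suffices that adjoining all semantic
-- consequences of Σ′ keeps it consistent.
module Submission where

open import Defs
open import Level using (Level)
open import Algebra.Core using (Op₁; Op₂)
open import Algebra.Definitions using (Commutative)
open import Algebra.Structures using (IsRingWithoutOne)
open import Data.Bool.Base as Bool using (Bool; true; false; not)
open import Data.Bool.Properties using (∧-inverseʳ; ∧-comm; ∨-assoc; ∨-comm)
open import Data.Nat.Base using (ℕ)
open import Data.Product.Base using (∃; Σ-syntax; _×_; _,_)
open import Data.Sum.Base using (inj₁; inj₂; [_,_])
open import Function.Base using (id; _∘_)
open import Function.Bundles using (_↔_; Inverse)
open import Relation.Binary.PropositionalEquality
  using (_≡_; refl; sym; trans; cong; cong₂)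
open import Relation.Nullary.Negation.Core using (contradiction)
open import Relation.Unary using (Pred; _∈_; _⊆_; _∪_; ｛_｝)

private
  variable
    ℓ ℓ′ : Level
    A : Set

infix 4 _⊩_ _⊨_

_⊩_ : (A → Bool) → Pred (Formula A) ℓ → Set ℓ
v ⊩ Γ = ∀ α → α ∈ Γ → eval v α ≡ true

_⊨_ : Formula A → Formula A → Set
α ⊨ β = ∀ v → eval v α ≡ true → eval v β ≡ true

⊩-extend : ∀ {v : A → Bool} {Γ : Pred (Formula A) ℓ} {α} →
           v ⊩ Γ → eval v α ≡ true → v ⊩ Γ ∪ ｛ α ｝
⊩-extend v⊩Γ vα β = [ v⊩Γ β , (λ { refl → vα }) ]

clash : ∀ {b} {W : Set} → b ≡ true → not b ≡ true → W
clash refl ()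

-- Induction on the derivation. Where a rule discharges a hypothesis, the value of that hypothesis
-- at `v` decides whether `v` also satisfies the extended premises, and so which subderivations may
-- be used.
sound : ∀ {Γ : Pred (Formula A) ℓ} {α} → Γ ⊢ α →
        ∀ v → v ⊩ Γ → eval v α ≡ true
sound (ax α∈Γ) v m = m _ α∈Γ
sound (∧I d e) v m = cong₂ Bool._∧_ (sound d v m) (sound e v m)
sound (∧E₁ {α = α} d) v m with eval v α | sound d v m
... | true  | _ = refl
... | false | ()
sound (∧E₂ {α = α} d) v m with eval v α | sound d v m
... | true  | vβ = vβ
... | false | ()
sound (∨I₁ {β = β} d) v m = cong (Bool._∨ eval v β) (sound d v m)
sound (∨I₂ {α = α} d) v m with eval v α
... | true  = refl
... | false = sound d v m
sound (∨E {α = α} d e f) v m with eval v α in vα | sound d v m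
... | true  | _  = sound e v (⊩-extend m vα)
... | false | vβ = sound f v (⊩-extend m vβ)
sound (¬I {α = α} d e) v m with eval v α in vα
... | true  = clash (sound d v m′) (sound e v m′)
  where m′ = ⊩-extend m vα
... | false = refl
sound (RAA {α = α} d e) v m with eval v α in vα
... | true  = refl
... | false = clash (sound d v m′) (sound e v m′)
  where m′ = ⊩-extend m (cong not vα)

∪-monoˡ : ∀ (Γ : Pred (Formula A) ℓ) {Δ : Pred (Formula A) ℓ′} {α} →
          Γ ⊆ Δ → Γ ∪ ｛ α ｝ ⊆ Δ ∪ ｛ α ｝
∪-monoˡ _ Γ⊆Δ = [ inj₁ ∘ Γ⊆Δ , inj₂ ]

weaken : ∀ {Γ : Pred (Formula A) ℓ} {Δ : Pred (Formula A) ℓ′} {α} →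
         Γ ⊆ Δ → Γ ⊢ α → Δ ⊢ α
weaken s (ax α∈Γ)   = ax (s α∈Γ)
weaken s (∧I d e)   = ∧I (weaken s d) (weaken s e)
weaken s (∧E₁ d)    = ∧E₁ (weaken s d)
weaken s (∧E₂ d)    = ∧E₂ (weaken s d)
weaken s (∨I₁ d)    = ∨I₁ (weaken s d)
weaken s (∨I₂ d)    = ∨I₂ (weaken s d)
weaken {Γ = Γ} s (∨E d e f) =
  ∨E (weaken s d) (weaken (∪-monoˡ Γ s) e) (weaken (∪-monoˡ Γ s) f)
weaken {Γ = Γ} s (¬I d e)   = ¬I (weaken (∪-monoˡ Γ s) d) (weaken (∪-monoˡ Γ s) e)
weaken {Γ = Γ} s (RAA d e)  = RAA (weaken (∪-monoˡ Γ s) d) (weaken (∪-monoˡ Γ s) e)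

⊢-extend : ∀ (Γ : Pred (Formula A) ℓ) {Δ : Pred (Formula A) ℓ′} {α} →
           Γ ⊆ (Δ ⊢_) → Γ ∪ ｛ α ｝ ⊆ (Δ ∪ ｛ α ｝ ⊢_)
⊢-extend _ s = [ weaken inj₁ ∘ s , ax ∘ inj₂ ]

-- Each use of a premise is replaced by its derivation, weakened under discharged hypotheses. This
-- carries a contradiction among consequences of a set back to the set itself.
cut : ∀ {Γ : Pred (Formula A) ℓ} {Δ : Pred (Formula A) ℓ′} {α} →
      Γ ⊆ (Δ ⊢_) → Γ ⊢ α → Δ ⊢ α
cut s (ax α∈Γ)   = s α∈Γ
cut s (∧I d e)   = ∧I (cut s d) (cut s e)
cut s (∧E₁ d)    = ∧E₁ (cut s d)
cut s (∧E₂ d)    = ∧E₂ (cut s d)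
cut s (∨I₁ d)    = ∨I₁ (cut s d)
cut s (∨I₂ d)    = ∨I₂ (cut s d)
cut {Γ = Γ} s (∨E d e f) =
  ∨E (cut s d) (cut (⊢-extend Γ s) e) (cut (⊢-extend Γ s) f)
cut {Γ = Γ} s (¬I d e)   = ¬I (cut (⊢-extend Γ s) d) (cut (⊢-extend Γ s) e)
cut {Γ = Γ} s (RAA d e)  = RAA (cut (⊢-extend Γ s) d) (cut (⊢-extend Γ s) e)

modus-ponens : ∀ {Γ : Pred (Formula A) ℓ} {α β} → Γ ⊢ α → Γ ⊢ ¬ α ∨ β → Γ ⊢ β
modus-ponens d e =
  -- In the case `¬ α`, `RAA` serves as ex falso: `d` clashes with the case hypothesis, whatever is
  -- assumed about β.
  ∨E e (RAA (weaken (inj₁ ∘ inj₁) d) (ax (inj₁ (inj₂ refl)))) (ax (inj₂ refl))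

-- If α ⊨ β then γ ≋ γ ∧ (¬ α ∨ β), so any member γ of Γ makes the implication
-- available, and completeness of the calculus is not needed.
⊢-entailed : ∀ (Γ : PropositionSet A ℓ) → Element Γ →
             ∀ {α β} → ⟦ Γ ⟧ ⊢ α → α ⊨ β → ⟦ Γ ⟧ ⊢ β
⊢-entailed Γ (γ , γ∈Γ) {α} {β} d α⊨β =
  modus-ponens d (∧E₂ {α = γ} (ax (resp Γ γ≋γ∧[α⇒β] γ∈Γ)))
  where
  γ≋γ∧[α⇒β] : γ ≋ γ ∧ (¬ α ∨ β)
  γ≋γ∧[α⇒β] v with eval v γ | eval v α in vα
  ... | false | _     = refl
  ... | true  | false = refl
  ... | true  | true  = sym (α⊨β v vα)

-- The entailment after the derivation makes the set closed under `≋`: `resp` just prolongs it.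
consequences : PropositionSet A ℓ → PropositionSet A ℓ
consequences Γ = record
  { ⟦_⟧  = λ β → ∃ λ α → (⟦ Γ ⟧ ⊢ α) × (α ⊨ β)
  ; resp = λ β≋β′ (α , d , α⊨β) → α , d , λ v vα → trans (sym (β≋β′ v)) (α⊨β v vα)
  }

-- An inhabited Γ derives its consequences; an empty one has only tautologies
-- as consequences.  Refuting both cases yields the (negative) conclusion.
consequences-consistent : (Γ : PropositionSet A ℓ) → Consistent Γ →
                          Consistent (consequences Γ)
consequences-consistent {A} Γ con (χ , d , e) =
  clash (sound d v v⊩) (sound e v v⊩)
  where
  empty : Element Γ → ∀ {W : Set} → W
  empty γ = contradiction (χ , cut derivable d , cut derivable e) con
    where
    derivable : ⟦ consequences Γ ⟧ ⊆ (⟦ Γ ⟧ ⊢_)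
    derivable (α , d , α⊨β) = ⊢-entailed Γ γ d α⊨β

  -- An arbitrary choice: once Γ is known to have no members, every valuation satisfies it
  -- vacuously.
  v : A → Bool
  v _ = true

  v⊩ : v ⊩ ⟦ consequences Γ ⟧
  v⊩ _ (_ , d , α⊨β) = α⊨β v (sound d v (λ γ γ∈Γ → empty (γ , γ∈Γ)))

maximal-closed : (Γ : PropositionSet A ℓ) → MaximalConsistent Γ →
                 ∀ {α β} → ⟦ Γ ⟧ ⊢ α → α ⊨ β → β ∈ ⟦ Γ ⟧
maximal-closed Γ (con , max) d α⊨β =
  max (consequences Γ) (consequences-consistent Γ con)
      (λ {α} α∈Γ → α , ax α∈Γ , λ _ → id) (_ , d , α⊨β)

-- Derivable even from an empty Γ, so it gives the ring a zero before any member of Σ′ is at hand.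
noncontradiction : ∀ {Γ : Pred (Formula A) ℓ} α → Γ ⊢ ¬ (α ∧ ¬ α)
noncontradiction α = ¬I (∧E₁ (ax (inj₂ refl))) (∧E₂ (ax (inj₂ refl)))

infix 5 _⇔_

-- The truth function of `l`, to which `eval v (α l β)` unfolds by computation; it is addition
-- modulo 2 with `true` in the role of 0.
_⇔_ : Op₂ Bool
a ⇔ b = (not a Bool.∨ b) Bool.∧ (not b Bool.∨ a)

⇔-self : ∀ a → (a ⇔ a) ≡ true
⇔-self true  = refl
⇔-self false = refl

⇔-identityˡ : ∀ a → (true ⇔ a) ≡ a
⇔-identityˡ true  = refl
⇔-identityˡ false = refl

⇔-comm : ∀ a b → (a ⇔ b) ≡ (b ⇔ a)
⇔-comm a b = ∧-comm (not a Bool.∨ b) (not b Bool.∨ a)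

⇔-identityʳ : ∀ a → (a ⇔ true) ≡ a
⇔-identityʳ a = trans (⇔-comm a true) (⇔-identityˡ a)

⇔-assoc : ∀ a b c → ((a ⇔ b) ⇔ c) ≡ (a ⇔ (b ⇔ c))
⇔-assoc true  b c =
  trans (cong (_⇔ c) (⇔-identityˡ b)) (sym (⇔-identityˡ (b ⇔ c)))
⇔-assoc false true  true  = refl
⇔-assoc false true  false = refl
⇔-assoc false false true  = refl
⇔-assoc false false false = refl

∨-distribˡ-⇔ : ∀ a b c → (a Bool.∨ (b ⇔ c)) ≡ ((a Bool.∨ b) ⇔ (a Bool.∨ c))
∨-distribˡ-⇔ true  b c = refl
∨-distribˡ-⇔ false b c = refl

∨-distribʳ-⇔ : ∀ a b c → ((b ⇔ c) Bool.∨ a) ≡ ((b Bool.∨ a) ⇔ (c Bool.∨ a))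
∨-distribʳ-⇔ a b c =
  trans (∨-comm (b ⇔ c) a)
    (trans (∨-distribˡ-⇔ a b c) (cong₂ _⇔_ (∨-comm a b) (∨-comm a c)))

⊨-l : ∀ (α β : Formula A) → α ∧ β ⊨ α l β
⊨-l α β v vαβ with eval v α | eval v β | vαβ
... | true  | true  | _ = refl
... | true  | false | ()
... | false | _     | ()

⊨-∨ : ∀ (α β : Formula A) → α ⊨ α ∨ β
⊨-∨ α β v vα = cong (Bool._∨ eval v β) vα

theorem3p9 : ∀ {ℓ : Level} (A : Set) → (A ↔ ℕ) →
    (Σ Σ′ : PropositionSet A ℓ) →
    Consistent Σ → ⟦ Σ ⟧ ⊆ ⟦ Σ′ ⟧ → MaximalConsistent Σ′ →
    Σ[ l-closed ∈ ClosedUnder Σ′ _l_ ]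
    Σ[ ∨-closed ∈ ClosedUnder Σ′ _∨_ ]
    Σ[ neg ∈ Op₁ (Element Σ′) ]
    Σ[ zer ∈ Element Σ′ ]
    (IsRingWithoutOne (Equal Σ′) (restrict Σ′ _l_ l-closed) (restrict Σ′ _∨_ ∨-closed) neg zer
    × Commutative (Equal Σ′) (restrict Σ′ _∨_ ∨-closed))
theorem3p9 A A↔ℕ _ Σ′ _ _ maximal =
  l-closed , ∨-closed , id , (⊤ , maximal-closed Σ′ maximal (noncontradiction p) (λ _ → id)) ,
  isRing , λ x y v → ∨-comm (⟪ x ⟫ v) (⟪ y ⟫ v)
  where
  p : Formula A
  -- Formulas have no constant for truth, so the zero is built from a letter; the choice of index 0
  -- is arbitrary.
  p = atom (Inverse.from A↔ℕ 0)

  ⊤ : Formula A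
  ⊤ = ¬ (p ∧ ¬ p)

  ⟪_⟫ : Element Σ′ → (A → Bool) → Bool
  ⟪ α , _ ⟫ v = eval v α

  ⊤-true : ∀ v → eval v ⊤ ≡ true
  ⊤-true v = cong not (∧-inverseʳ (eval v p))

  l-closed : ClosedUnder Σ′ _l_
  l-closed α β α∈Σ′ β∈Σ′ = maximal-closed Σ′ maximal (∧I (ax α∈Σ′) (ax β∈Σ′)) (⊨-l α β)

  ∨-closed : ClosedUnder Σ′ _∨_
  ∨-closed α β α∈Σ′ _ = maximal-closed Σ′ maximal (ax α∈Σ′) (⊨-∨ α β)

  isRing : IsRingWithoutOne (Equal Σ′) (restrict Σ′ _l_ l-closed) (restrict Σ′ _∨_ ∨-closed) id _
  isRing = record
    { +-isAbelianGroup = record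
      { isGroup = record
        { isMonoid = record
          { isSemigroup = record
            { isMagma = record
              { isEquivalence = record
                { refl  = λ _ → refl
                ; sym   = λ x≋y v → sym (x≋y v)
                ; trans = λ x≋y y≋z v → trans (x≋y v) (y≋z v)
                }
              ; ∙-cong = λ x≋y u≋w v → cong₂ _⇔_ (x≋y v) (u≋w v)
              }
            ; assoc = λ x y z v → ⇔-assoc (⟪ x ⟫ v) (⟪ y ⟫ v) (⟪ z ⟫ v)
            }
          -- The value of `⊤` is stuck on the unknown value of `p`, so `⊤-true` rewrites it to
          -- `true` before the Boolean law applies.
          ; identity =
              (λ x v → trans (cong (_⇔ ⟪ x ⟫ v) (⊤-true v)) (⇔-identityˡ (⟪ x ⟫ v))) ,
              (λ x v → trans (cong (⟪ x ⟫ v ⇔_) (⊤-true v)) (⇔-identityʳ (⟪ x ⟫ v)))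
          }
        ; inverse =
            (λ x v → trans (⇔-self (⟪ x ⟫ v)) (sym (⊤-true v))) ,
            (λ x v → trans (⇔-self (⟪ x ⟫ v)) (sym (⊤-true v)))
        ; ⁻¹-cong = id
        }
      ; comm = λ x y v → ⇔-comm (⟪ x ⟫ v) (⟪ y ⟫ v)
      }
    ; *-cong  = λ x≋y u≋w v → cong₂ Bool._∨_ (x≋y v) (u≋w v)
    ; *-assoc = λ x y z v → ∨-assoc (⟪ x ⟫ v) (⟪ y ⟫ v) (⟪ z ⟫ v)
    ; distrib =
        (λ x y z v → ∨-distribˡ-⇔ (⟪ x ⟫ v) (⟪ y ⟫ v) (⟪ z ⟫ v)) ,
        (λ x y z v → ∨-distribʳ-⇔ (⟪ x ⟫ v) (⟪ y ⟫ v) (⟪ z ⟫ v))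
    }
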